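{- Let $G$ be a group acting on a set $X$. Let $A\subseteq X$, $B\subseteq G$, $N\in\mathbb N$. Let $\mathcal D'$ be the set of finite intersections of translates $gB$ ($g\in G$). Let $\mathcal D$ be a $G$-lattice of subsets of $X$ including $A$ and $B'A$ for every $B'\in\mathcal D'$. Let $m$ be an invariant mean on $\mathcal D$ with $m(A)>0$, and let $m'$ be an invariant mean on the lattice (of subsets of $G$) generated by $\mathcal D'$, with $m'(B)>0$. Then there exists a generic, symmetric set $Y\subseteq G$ that is positively definable in $(G,\cdot,B)$ over parameters from $G$, and such that $Y^N\subseteq\mathrm{St}_1(BA)$.
   Context: A $G$-lattice of subsets of a $G$-set $X$ is a family of subsets of $X$ including $\emptyset$ and $X$, closed under $G$-translations and under intersections and unions of pairs (for $X=G$, $G$ acts by left translation). A mean on a $G$-lattice $\mathcal D$ is a non-negative, monotone, translation-invariant function $m:\mathcal D\to\mathbb R$ with $m(\emptyset)=0$ and $m(Y\cup Z)=m(Y)+m(Z)-m(Y\cap Z)$ for $Y,Z\in\mathcal D$. For $\epsilon\in\mathbb R$ and $Y\in\mathcal D$, $\mathrm{St}_\epsilon(Y):=\{g\in G:m(gY\cap Y)>(1-\epsilon)m(Y)\}$, so $\mathrm{St}_1(BA)=\{g\in G: m(gBA\cap BA)>0\}$, where $BA=\{ba:b\in B,a\in A\}$. A subset of $G$ is generic if finitely many left translates of it cover $G$; it is symmetric if it contains $1$ and is closed under inversion. $Y^N$ is the $N$-fold product set. Positively definable in $(G,\cdot,B)$ over parameters from $G$ means definable by a positive formula (built from atomic formulas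 using only $\wedge,\vee,\exists,\forall$, no negation) in the group language with a predicate for $B$, with parameters from $G$. -}

module Defs where

open import Level using (Level; 0ℓ; _⊔_) renaming (suc to lsuc)
open import Algebra.Bundles using (CommutativeRing; Group)
open import Data.Empty.Polymorphic using (⊥)
open import Data.Fin.Base using (Fin)
open import Data.List.Base using (List)
open import Data.List.NonEmpty.Base using (List⁺; toList) renaming ([_] to [_]⁺)
open import Data.List.Relation.Unary.All using (All; []; _∷_)
import Data.List.Relation.Unary.All as All
open import Data.List.Relation.Unary.Any using (Any)
open import Data.Nat.Base using (ℕ; zero; suc)
open import Data.Product.Base using (Σ; ∃; _×_; _,_)
open import Data.Sum.Base using (_⊎_; inj₁; inj₂)
open import Data.Unit.Polymorphic using (⊤)
open import Data.Vec.Base using (Vec; lookup; _∷_)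
open import Function.Bundles using (_⇔_)
open import Relation.Binary.Bundles using (Setoid)
open import Relation.Binary.Core using (Rel)
open import Relation.Binary.Definitions using (_Respects_)
import Relation.Binary.Construct.NonStrictToStrict as ToStrict
open import Relation.Binary.Structures using (IsTotalOrder)
open import Relation.Nullary using (¬_)
open import Relation.Unary using (Pred)

-- Classically a complete ordered field is unique up to isomorphism, so a
-- statement about all of these is a statement about the real numbers.

record CompleteOrderedField : Set₁ where
  infix 4 _≤_
  field
    commutativeRing : CommutativeRing 0ℓ 0ℓ
  open CommutativeRing commutativeRing public
  field
    _≤_          : Rel Carrier 0ℓ
    isTotalOrder : IsTotalOrder _≈_ _≤_
    0≉1          : ¬ (0# ≈ 1#)
    inverse      : ∀ x → ¬ (x ≈ 0#) → ∃ λ y → x * y ≈ 1#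
    +-monoˡ-≤    : ∀ {x y} z → x ≤ y → x + z ≤ y + z
    *-nonNeg     : ∀ {x y} → 0# ≤ x → 0# ≤ y → 0# ≤ x * y

  UpperBound : Pred Carrier 0ℓ → Pred Carrier 0ℓ
  UpperBound P u = ∀ {x} → P x → x ≤ u

  field
    supremum : (P : Pred Carrier 0ℓ) → ∃ P → ∃ (UpperBound P) →
               ∃ λ s → UpperBound P s × (∀ {u} → UpperBound P u → s ≤ u)

  open ToStrict _≈_ _≤_ public using (_<_)

record Subset {ℓ} (S : Setoid ℓ ℓ) : Set (lsuc ℓ) where
  open Setoid S
  field
    member   : Pred Carrier ℓ
    respects : member Respects _≈_

module _ {ℓ} {S : Setoid ℓ ℓ} where
  open Setoid S using (Carrier)

  infix 4 _∈_ _⊆_ _≐_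
  infixr 7 _∩_
  infixr 6 _∪_

  _∈_ : Carrier → Subset S → Set ℓ
  x ∈ Y = Subset.member Y x

  _⊆_ _≐_ : Subset S → Subset S → Set ℓ
  Y ⊆ Z = ∀ {x} → x ∈ Y → x ∈ Z
  Y ≐ Z = Y ⊆ Z × Z ⊆ Y

  ∅ : Subset S
  ∅ = record { member = λ _ → ⊥ ; respects = λ _ () }

  full : Subset S
  full = record { member = λ _ → ⊤ ; respects = λ _ t → t }

  _∩_ : Subset S → Subset S → Subset S
  Y ∩ Z = record
    { member   = λ x → x ∈ Y × x ∈ Z
    ; respects = λ eq (y , z) → Subset.respects Y eq y , Subset.respects Z eq z
    }

  _∪_ : Subset S → Subset S → Subset S
  Y ∪ Z = record
    { member   = λ x → x ∈ Y ⊎ x ∈ Z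
    ; respects = λ { eq (inj₁ y) → inj₁ (Subset.respects Y eq y)
                   ; eq (inj₂ z) → inj₂ (Subset.respects Z eq z) }
    }

record GSet {ℓ} (G : Group ℓ ℓ) : Set (lsuc ℓ) where
  private module G = Group G
  infixr 8 _▹_
  field
    setoid : Setoid ℓ ℓ
  open Setoid setoid public
  field
    _▹_    : G.Carrier → Carrier → Carrier
    ▹-cong : ∀ {g h x y} → g G.≈ h → x ≈ y → g ▹ x ≈ h ▹ y
    ε-▹    : ∀ x → G.ε ▹ x ≈ x
    ∙-▹    : ∀ g h x → (g G.∙ h) ▹ x ≈ g ▹ h ▹ x

leftTranslation : ∀ {ℓ} (G : Group ℓ ℓ) → GSet G
leftTranslation G = record
  { setoid = setoid
  ; _▹_    = _∙_
  ; ▹-cong = ∙-cong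
  ; ε-▹    = identityˡ
  ; ∙-▹    = assoc
  }
  where open Group G

SubsetOf : ∀ {ℓ} {G : Group ℓ ℓ} → GSet G → Set (lsuc ℓ)
SubsetOf X = Subset (GSet.setoid X)

GroupSubset : ∀ {ℓ} → Group ℓ ℓ → Set (lsuc ℓ)
GroupSubset G = SubsetOf (leftTranslation G)

module _ {ℓ} {G : Group ℓ ℓ} (X : GSet G) where
  private
    module G = Group G
    module X = GSet X

  translate : G.Carrier → SubsetOf X → SubsetOf X
  translate g Y = record
    { member   = λ x → ∃ λ y → y ∈ Y × x X.≈ g X.▹ y
    ; respects = λ eq (y , y∈Y , x≈gy) → y , y∈Y , X.trans (X.sym eq) x≈gy
    }

  product : GroupSubset G → SubsetOf X → SubsetOf X
  product B A = record
    { member   = λ x → ∃ λ b → ∃ λ a → b ∈ B × a ∈ A × x X.≈ b X.▹ a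
    ; respects = λ eq (b , a , b∈B , a∈A , x≈ba) →
                   b , a , b∈B , a∈A , X.trans (X.sym eq) x≈ba
    }

  -- The field resp makes Member a family of sets up to extensional equality.
  record GLattice (d : Level) : Set (lsuc (ℓ ⊔ d)) where
    field
      Member      : SubsetOf X → Set d
      resp        : ∀ {Y Z} → Y ≐ Z → Member Y → Member Z
      ∅∈          : Member ∅
      full∈       : Member full
      translate∈  : ∀ g {Y} → Member Y → Member (translate g Y)
      ∩∈          : ∀ {Y Z} → Member Y → Member Z → Member (Y ∩ Z)
      ∪∈          : ∀ {Y Z} → Member Y → Member Z → Member (Y ∪ Z)

  data Generated {d} (F : SubsetOf X → Set d) : SubsetOf X → Set (lsuc ℓ ⊔ d) where
    base        : ∀ {Y} → F Y → Generated F Y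
    extensional : ∀ {Y Z} → Y ≐ Z → Generated F Y → Generated F Z
    empty       : Generated F ∅
    whole       : Generated F full
    translated  : ∀ g {Y} → Generated F Y → Generated F (translate g Y)
    meet        : ∀ {Y Z} → Generated F Y → Generated F Z → Generated F (Y ∩ Z)
    join        : ∀ {Y Z} → Generated F Y → Generated F Z → Generated F (Y ∪ Z)

  generatedLattice : ∀ {d} → (SubsetOf X → Set d) → GLattice (lsuc ℓ ⊔ d)
  generatedLattice F = record
    { Member     = Generated F
    ; resp       = extensional
    ; ∅∈         = empty
    ; full∈      = whole
    ; translate∈ = translated
    ; ∩∈         = meet
    ; ∪∈         = join
    }

  module _ (ℝ : CompleteOrderedField) {d} (𝒟 : GLattice d) where
    private module ℝ = CompleteOrderedField ℝ
    open GLattice 𝒟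

    -- By monotonicity and antisymmetry, the value of a mean at Y depends neither
    -- on the proof that Y lies in 𝒟 nor on Y beyond extensional equality.
    record Mean : Set (lsuc ℓ ⊔ d) where
      field
        value     : ∀ {Y} → Member Y → ℝ.Carrier
        nonNeg    : ∀ {Y} (y : Member Y) → ℝ.0# ℝ.≤ value y
        monotone  : ∀ {Y Z} (y : Member Y) (z : Member Z) → Y ⊆ Z → value y ℝ.≤ value z
        invariant : ∀ g {Y} (y : Member Y) → value (translate∈ g y) ℝ.≈ value y
        mean-∅    : value ∅∈ ℝ.≈ ℝ.0#
        modular   : ∀ {Y Z} (y : Member Y) (z : Member Z) →
                    value (∪∈ y z) ℝ.≈ (value y ℝ.+ value z) ℝ.- value (∩∈ y z)

    St : Mean → ℝ.Carrier → ∀ {Y} → Member Y → Pred G.Carrier 0ℓ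
    St m ε y g = (ℝ.1# ℝ.- ε) ℝ.* value y ℝ.< value (∩∈ (translate∈ g y) y)
      where open Mean m

infix 4 _∈ᴸ_
_∈ᴸ_ : ∀ {ℓ d} {G : Group ℓ ℓ} {X : GSet G} → SubsetOf X → GLattice X d → Set d
Y ∈ᴸ 𝒟 = GLattice.Member 𝒟 Y

module _ {ℓ} (G : Group ℓ ℓ) where
  open Group G
  private GG = leftTranslation G

  ⋂-translates : GroupSubset G → List Carrier → GroupSubset G
  ⋂-translates B gs = record
    { member   = λ x → All (λ g → x ∈ translate GG g B) gs
    ; respects = λ eq → All.map (λ {g} → Subset.respects (translate GG g B) eq)
    }

  -- Only intersections of at least one translate are taken, so G itself is not
  -- automatically included.
  FiniteIntersection : GroupSubset G → GroupSubset G → Set ℓ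
  FiniteIntersection B C = ∃ λ (gs : List⁺ Carrier) → C ≐ ⋂-translates B (toList gs)

  self-intersection : (B : GroupSubset G) → FiniteIntersection B B
  self-intersection B = [ ε ]⁺ ,
    (λ {x} x∈B → (x , x∈B , sym (identityˡ x)) ∷ []) ,
    (λ { ((y , y∈B , x≈εy) ∷ []) →
         Subset.respects B (sym (trans x≈εy (identityˡ y))) y∈B })

  translateLattice : GroupSubset G → GLattice GG (lsuc ℓ)
  translateLattice B = generatedLattice GG (FiniteIntersection B)

  self∈translateLattice : (B : GroupSubset G) → B ∈ᴸ translateLattice B
  self∈translateLattice B = base (self-intersection B)

  Generic : GroupSubset G → Set ℓ
  Generic Y = ∃ λ (gs : List Carrier) → ∀ x → Any (λ g → x ∈ translate GG g Y) gs

  SymmetricSet : GroupSubset G → Set ℓ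
  SymmetricSet Y = ε ∈ Y × (∀ {x} → x ∈ Y → x ⁻¹ ∈ Y)

  power : GroupSubset G → ℕ → GroupSubset G
  power Y zero    = record
    { member   = λ x → x ≈ ε
    ; respects = λ x≈y x≈ε → trans (sym x≈y) x≈ε
    }
  power Y (suc n) = product GG Y (power Y n)

infixl 7 _·ᵗ_
infix  5 _≈ᶠ_
infixr 4 _∧ᶠ_
infixr 3 _∨ᶠ_

data Term (n : ℕ) : Set where
  var  : Fin n → Term n
  1ᵗ   : Term n
  _·ᵗ_ : Term n → Term n → Term n
  invᵗ : Term n → Term n

-- Positive first-order formulas with n free variables over the language of groups
-- with a unary predicate; quantifiers bind the variable of index zero.
data PositiveFormula (n : ℕ) : Set where
  _≈ᶠ_      : Term n → Term n → PositiveFormula n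
  predicate : Term n → PositiveFormula n
  _∧ᶠ_ _∨ᶠ_ : PositiveFormula n → PositiveFormula n → PositiveFormula n
  ∃ᶠ ∀ᶠ     : PositiveFormula (suc n) → PositiveFormula n

module _ {ℓ} (G : Group ℓ ℓ) where
  open Group G

  evaluate : ∀ {n} → Term n → Vec Carrier n → Carrier
  evaluate (var i)  ρ = lookup ρ i
  evaluate 1ᵗ       ρ = ε
  evaluate (s ·ᵗ t) ρ = evaluate s ρ ∙ evaluate t ρ
  evaluate (invᵗ t) ρ = evaluate t ρ ⁻¹

  Satisfies : GroupSubset G → ∀ {n} → PositiveFormula n → Vec Carrier n → Set ℓ
  Satisfies B (s ≈ᶠ t)      ρ = evaluate s ρ ≈ evaluate t ρ
  Satisfies B (predicate t) ρ = evaluate t ρ ∈ B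
  Satisfies B (φ ∧ᶠ ψ)      ρ = Satisfies B φ ρ × Satisfies B ψ ρ
  Satisfies B (φ ∨ᶠ ψ)      ρ = Satisfies B φ ρ ⊎ Satisfies B ψ ρ
  Satisfies B (∃ᶠ φ)        ρ = ∃ λ x → Satisfies B φ (x ∷ ρ)
  Satisfies B (∀ᶠ φ)        ρ = ∀ x → Satisfies B φ (x ∷ ρ)

  PositivelyDefinable : GroupSubset G → GroupSubset G → Set ℓ
  PositivelyDefinable B Y =
    ∃ λ k → Σ (PositiveFormula (suc k)) λ φ → Σ (Vec Carrier k) λ parameters →
      ∀ x → x ∈ Y ⇔ Satisfies B φ (x ∷ parameters)

{-# OPTIONS --safe #-}
module Submission where

-- The measure argument of Massicot-Wagner and Sanders, with the condition
-- "m'(C) is bounded below" replaced by positive first-order conditions Large ks.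
-- Since m'(G) is finite, among enough translates of a set of measure ≥ t two meet
-- in a set of measure ≥ t', for a t' > 0 depending only on t; iterating this M
-- times shows that B is Large for some ks of length M.  Pass from C = B to gC ∩ C,
-- each time giving up one entry of ks, as long as this decreases m(CA) by more than
-- δ = m(A)/(N+1).  As m(CA) ≥ 0, this stops before M steps when M δ > m(BA), at some
-- C ⊆ B.  The set Y of those g for which gC ∩ C is still large is generic, and
-- m(gCA ∩ CA) ≥ m(CA) - δ on it, hence m(gCA ∩ CA) ≥ m(A) - N δ > 0 for g in Y^N.

open import Defs
open import Level using (Level)
open import Algebra.Bundles using (Group)
import Algebra.Properties.Group as GroupProperties
import Algebra.Properties.Monoid.Mult as MonoidMult
import Algebra.Properties.Semiring.Mult as SemiringMult
open import Axiom.ExcludedMiddle using (ExcludedMiddle)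
open import Data.Fin.Base using (zero; suc)
open import Data.List.Base using (List; []; _∷_; _++_; map; length; tabulate; foldr)
open import Data.List.NonEmpty.Base using (List⁺; toList; _∷_; _⁺++⁺_)
import Data.List.NonEmpty.Base as List⁺
open import Data.List.Properties using (map-++; map-∘; map-cong; map-tabulate; tabulate-cong; tabulate-lookup)
import Data.List.Base as List
open import Data.List.Relation.Unary.All using (All; []; _∷_)
import Data.List.Relation.Unary.All as All
import Data.List.Relation.Unary.All.Properties as All
open import Data.List.Relation.Unary.Any using (Any; here; there)
import Data.List.Relation.Unary.Any as Any
import Data.List.Relation.Unary.Any.Properties as Any
open import Data.Nat.Base using (ℕ; zero; suc)
import Data.Nat.Base as ℕ
import Data.Nat.Properties as ℕ
open import Data.Product.Base using (∃; Σ; _×_; _,_; proj₁; proj₂)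
open import Data.Product.Function.NonDependent.Propositional using (_×-⇔_)
open import Data.Sum.Base using (_⊎_; inj₁; inj₂)
import Data.Sum.Base as Sum
open import Data.Sum.Function.Propositional using (_⊎-⇔_)
open import Data.Vec.Base using (Vec; head; tail; _∷_)
import Data.Vec.Base as Vec
open import Data.Vec.Properties using (lookup∘tabulate)
open import Function.Base using (_∘_)
open import Function.Bundles using (_⇔_; mk⇔; Equivalence)
open import Function.Construct.Composition using (_⇔-∘_)
open import Relation.Binary.Bundles using (Poset)
import Relation.Binary.Construct.NonStrictToStrict as ToStrict
import Relation.Binary.Reasoning.PartialOrder as PartialOrderReasoning
open import Relation.Binary.PropositionalEquality as ≡ using (_≡_)
open import Relation.Binary.Structures using (IsTotalOrder)
open import Relation.Nullary using (¬_; yes; no; contradiction)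
open import Relation.Nullary.Decidable using (decidable-stable)

-- Ordered fields

module OrderedField (em : ∀ {a} → ExcludedMiddle a) (ℝ : CompleteOrderedField) where
  open CompleteOrderedField ℝ
  open IsTotalOrder isTotalOrder public using (antisym; total; isPartialOrder)
    renaming (refl to ≤-refl; trans to ≤-trans; reflexive to ≤-reflexive)
  open MonoidMult +-monoid public using () renaming (_×_ to _·_)
  open MonoidMult +-monoid using (×-congʳ)
  open SemiringMult semiring using (×-assoc-*)

  poset : Poset _ _ _
  poset = record { isPartialOrder = isPartialOrder }

  open PartialOrderReasoning poset

  <⇒≱ : ∀ {x y} → x < y → ¬ (y ≤ x)
  <⇒≱ = ToStrict.<⇒≱ _≈_ _≤_ antisym

  ≰⇒> : ∀ {x y} → ¬ (x ≤ y) → y < x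
  ≰⇒> = ToStrict.≰⇒> _≈_ _≤_ sym ≤-reflexive total

  ≮⇒≥ : ∀ {x y} → ¬ (x < y) → y ≤ x
  ≮⇒≥ {x} {y} x≮y = decidable-stable em λ y≰x → x≮y (≰⇒> y≰x)

  +-mono-≤ : ∀ {w x y z} → w ≤ x → y ≤ z → w + y ≤ x + z
  +-mono-≤ {w} {x} {y} {z} w≤x y≤z = begin
    w + y ≤⟨ +-monoˡ-≤ y w≤x ⟩
    x + y ≈⟨ +-comm x y ⟩
    y + x ≤⟨ +-monoˡ-≤ x y≤z ⟩
    z + x ≈⟨ +-comm z x ⟩
    x + z ∎

  +-cancelʳ-≤ : ∀ {x y} z → x + z ≤ y + z → x ≤ y
  +-cancelʳ-≤ {x} {y} z x+z≤y+z = begin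
    x           ≈⟨ //-rightDividesʳ z x ⟨
    x + z - z   ≤⟨ +-monoˡ-≤ (- z) x+z≤y+z ⟩
    y + z - z   ≈⟨ //-rightDividesʳ z y ⟩
    y           ∎
    where open GroupProperties +-group

  +-cancelʳ-< : ∀ {x y} z → x + z < y + z → x < y
  +-cancelʳ-< z x+z<y+z = ≰⇒> λ y≤x → <⇒≱ x+z<y+z (+-monoˡ-≤ z y≤x)

  x≤x+y : ∀ {x y} → 0# ≤ y → x ≤ x + y
  x≤x+y {x} {y} 0≤y = begin
    x      ≈⟨ +-identityʳ x ⟨
    x + 0# ≤⟨ +-mono-≤ ≤-refl 0≤y ⟩
    x + y  ∎

  ·-monoʳ-≤ : ∀ n {x y} → x ≤ y → n · x ≤ n · y
  ·-monoʳ-≤ zero    x≤y = ≤-refl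
  ·-monoʳ-≤ (suc n) x≤y = +-mono-≤ x≤y (·-monoʳ-≤ n x≤y)

  ·-nonNeg : ∀ n {x} → 0# ≤ x → 0# ≤ n · x
  ·-nonNeg zero    0≤x = ≤-refl
  ·-nonNeg (suc n) 0≤x = ≤-trans 0≤x (x≤x+y (·-nonNeg n 0≤x))

  ·-monoˡ-≤ : ∀ {m n x} → 0# ≤ x → m ℕ.≤ n → m · x ≤ n · x
  ·-monoˡ-≤ {n = n} 0≤x ℕ.z≤n       = ·-nonNeg n 0≤x
  ·-monoˡ-≤         0≤x (ℕ.s≤s m≤n) = +-mono-≤ ≤-refl (·-monoˡ-≤ 0≤x m≤n)

  -- If all multiples of `x` were bounded by `y`, their supremum `s` could be lowered to `s - x`,
  -- because a multiple plus `x` is again a multiple. This contradicts `0# < x`.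
  archimedean : ∀ {x} → 0# < x → ∀ y → ∃ λ n → y < n · x
  archimedean {x} 0<x y = decidable-stable em λ none →
    let multiple = λ z → ∃ λ n → z ≈ n · x
        bounded  = λ {z} (z∈ : multiple z) →
          ≤-trans (≤-reflexive (proj₂ z∈)) (≮⇒≥ λ y<nx → none (proj₁ z∈ , y<nx))
        s , s-upper , s-least = supremum multiple (0# , 0 , refl) (y , bounded)
        shifted  = λ {z} (z∈ : multiple z) →
          let n , z≈nx = z∈ in +-cancelʳ-≤ x (begin
            z + x          ≈⟨ +-congʳ z≈nx ⟩
            n · x + x      ≈⟨ +-comm (n · x) x ⟩
            suc n · x      ≤⟨ s-upper (suc n , refl) ⟩
            s              ≈⟨ //-rightDividesˡ x s ⟨
            (s - x) + x    ∎)
    in <⇒≱ 0<x (+-cancelʳ-≤ s (begin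
         x + s          ≤⟨ +-mono-≤ ≤-refl (s-least shifted) ⟩
         x + (s - x)    ≈⟨ +-comm x (s - x) ⟩
         (s - x) + x    ≈⟨ //-rightDividesˡ x s ⟩
         s              ≈⟨ +-identityˡ s ⟨
         0# + s         ∎))
    where open GroupProperties +-group

  divide : ∀ {x} → 0# < x → ∀ n → ∃ λ δ → 0# < δ × suc n · δ ≈ x
  divide {x} 0<x n = r⁻¹ * x , ≰⇒> δ≰0 , nδ≈x
    where
    r = suc n · 1#

    r*-≈ : ∀ z → r * z ≈ suc n · z
    r*-≈ z = trans (×-assoc-* (suc n) 1# z) (×-congʳ (suc n) (*-identityˡ z))

    -- The positive element `x` itself witnesses this: `r ≈ 0#` would give
    -- `x ≤ suc n · x ≈ r * x ≈ 0#`.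
    r≉0 : ¬ (r ≈ 0#)
    r≉0 r≈0 = <⇒≱ 0<x (begin
      x         ≤⟨ x≤x+y (·-nonNeg n (proj₁ 0<x)) ⟩
      suc n · x ≈⟨ r*-≈ x ⟨
      r * x     ≈⟨ *-congʳ r≈0 ⟩
      0# * x    ≈⟨ zeroˡ x ⟩
      0#        ∎)

    r⁻¹ = proj₁ (inverse r r≉0)

    nδ≈x : suc n · (r⁻¹ * x) ≈ x
    nδ≈x = begin-equality
      suc n · (r⁻¹ * x) ≈⟨ r*-≈ (r⁻¹ * x) ⟨
      r * (r⁻¹ * x)     ≈⟨ *-assoc r r⁻¹ x ⟨
      r * r⁻¹ * x       ≈⟨ *-congʳ (proj₂ (inverse r r≉0)) ⟩
      1# * x            ≈⟨ *-identityˡ x ⟩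
      x                 ∎

    δ≰0 : ¬ (r⁻¹ * x ≤ 0#)
    δ≰0 δ≤0 = <⇒≱ 0<x (begin
      x                 ≈⟨ nδ≈x ⟨
      suc n · (r⁻¹ * x) ≤⟨ ·-monoʳ-≤ (suc n) δ≤0 ⟩
      suc n · 0#        ≈⟨ r*-≈ 0# ⟨
      r * 0#            ≈⟨ zeroʳ r ⟩
      0#                ∎)

-- Translates, products and means

module Translates {ℓ} {G : Group ℓ ℓ} (X : GSet G) where
  private module G = Group G
  open G using (_∙_; _⁻¹)
  open GSet X

  ⁻¹-▹-cancelˡ : ∀ g x → (g ⁻¹) ▹ g ▹ x ≈ x
  ⁻¹-▹-cancelˡ g x = trans (sym (∙-▹ (g ⁻¹) g x)) (trans (▹-cong (G.inverseˡ g) refl) (ε-▹ x))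

  ⁻¹-▹-cancelʳ : ∀ g x → g ▹ (g ⁻¹) ▹ x ≈ x
  ⁻¹-▹-cancelʳ g x = trans (sym (∙-▹ g (g ⁻¹) x)) (trans (▹-cong (G.inverseʳ g) refl) (ε-▹ x))

  translate-∈ : ∀ g (Y : SubsetOf X) {y} → y ∈ Y → g ▹ y ∈ translate X g Y
  translate-∈ g Y y∈Y = _ , y∈Y , refl

  translate⁺ : ∀ g (Y : SubsetOf X) {x} → (g ⁻¹) ▹ x ∈ Y → x ∈ translate X g Y
  translate⁺ g Y {x} y∈Y = (g ⁻¹) ▹ x , y∈Y , sym (⁻¹-▹-cancelʳ g x)

  translate⁻ : ∀ g (Y : SubsetOf X) {x} → x ∈ translate X g Y → (g ⁻¹) ▹ x ∈ Y
  translate⁻ g Y {x} (y , y∈Y , x≈gy) =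
    Subset.respects Y (trans (sym (⁻¹-▹-cancelˡ g y)) (▹-cong G.refl (sym x≈gy))) y∈Y

  translate-mono : ∀ g (Y Z : SubsetOf X) → Y ⊆ Z → translate X g Y ⊆ translate X g Z
  translate-mono g Y Z Y⊆Z (y , y∈Y , eq) = y , Y⊆Z y∈Y , eq

  translate-cong : ∀ {g h} (Y : SubsetOf X) → g G.≈ h → translate X g Y ⊆ translate X h Y
  translate-cong Y g≈h (y , y∈Y , eq) = y , y∈Y , trans eq (▹-cong g≈h refl)

  translate-ε : ∀ (Y : SubsetOf X) → translate X G.ε Y ≐ Y
  translate-ε Y =
    (λ { (y , y∈Y , eq) → Subset.respects Y (sym (trans eq (ε-▹ y))) y∈Y }) ,
    (λ {x} x∈Y → x , x∈Y , sym (ε-▹ x))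

  translate-∙ : ∀ g h (Y : SubsetOf X) → translate X (g ∙ h) Y ≐ translate X g (translate X h Y)
  translate-∙ g h Y =
    (λ { (y , y∈Y , eq) → h ▹ y , translate-∈ h Y y∈Y , trans eq (∙-▹ g h y) }) ,
    (λ { (z , (y , y∈Y , z≈hy) , eq) →
         y , y∈Y , trans eq (trans (▹-cong G.refl z≈hy) (sym (∙-▹ g h y))) })

  translate-∩⁺ : ∀ g (Y Z : SubsetOf X) → translate X g Y ∩ translate X g Z ⊆ translate X g (Y ∩ Z)
  translate-∩⁺ g Y Z (gy , gz) = translate⁺ g (Y ∩ Z) (translate⁻ g Y gy , translate⁻ g Z gz)

  translate-∩⁻ : ∀ g (Y Z : SubsetOf X) → translate X g (Y ∩ Z) ⊆ translate X g Y ∩ translate X g Z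
  translate-∩⁻ g Y Z (y , (y∈Y , y∈Z) , eq) = (y , y∈Y , eq) , (y , y∈Z , eq)

  product-mono : ∀ (B C : GroupSubset G) (A : SubsetOf X) → B ⊆ C → product X B A ⊆ product X C A
  product-mono B C A B⊆C (b , a , b∈B , a∈A , eq) = b , a , B⊆C b∈B , a∈A , eq

  product-translate : ∀ g (C : GroupSubset G) (A : SubsetOf X) →
    product X (translate (leftTranslation G) g C) A ⊆ translate X g (product X C A)
  product-translate g C A (b , a , (c , c∈C , b≈gc) , a∈A , eq) =
    c ▹ a , (c , a , c∈C , a∈A , refl) , trans eq (trans (▹-cong b≈gc refl) (∙-▹ g c a))

  translate⊆product : ∀ {c} (C : GroupSubset G) (A : SubsetOf X) → c ∈ C → translate X c A ⊆ product X C A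
  translate⊆product {c} C A c∈C (a , a∈A , eq) = c , a , c∈C , a∈A , eq

module MeanProperties (em : ∀ {a} → ExcludedMiddle a) (ℝ : CompleteOrderedField)
  {ℓ d} {G : Group ℓ ℓ} {X : GSet G} {𝒟 : GLattice X d} (mean : Mean X ℝ 𝒟) where
  open CompleteOrderedField ℝ
  open OrderedField em ℝ
  open PartialOrderReasoning poset
  open GLattice 𝒟
  open Mean mean public renaming (value to μ)
  open Translates X

  μ-∪-∩ : ∀ {Y Z} (y : Member Y) (z : Member Z) → μ (∪∈ y z) + μ (∩∈ y z) ≈ μ y + μ z
  μ-∪-∩ y z = trans (+-congʳ (modular y z)) (//-rightDividesˡ _ _)
    where open GroupProperties +-group

  μ-∪-≤ : ∀ {Y Z} (y : Member Y) (z : Member Z) → μ (∪∈ y z) ≤ μ y + μ z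
  μ-∪-≤ y z = ≤-trans (x≤x+y (nonNeg (∩∈ y z))) (≤-reflexive (μ-∪-∩ y z))

  μ-positive⇒nonempty : ∀ {Y} (y : Member Y) → 0# < μ y → ∃ λ x → x ∈ Y
  μ-positive⇒nonempty y 0<μ = decidable-stable em λ none →
    <⇒≱ 0<μ (≤-trans (monotone y ∅∈ λ x∈Y → contradiction (_ , x∈Y) none) (≤-reflexive mean-∅))

  -- Both `P ∩ Q` and `Q ∩ R` lie in `Q`, and their intersection lies in `P ∩ R`; modularity does
  -- the rest. For sets of equal measure this is the triangle inequality for the distance m(P) - m(P
  -- ∩ Q).
  μ-∩-triangle : ∀ {P Q R} (p : Member P) (q : Member Q) (r : Member R) →
    μ (∩∈ p q) + μ (∩∈ q r) ≤ μ q + μ (∩∈ p r)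
  μ-∩-triangle p q r = begin
    μ (∩∈ p q) + μ (∩∈ q r)
      ≈⟨ μ-∪-∩ (∩∈ p q) (∩∈ q r) ⟨
    μ (∪∈ (∩∈ p q) (∩∈ q r)) + μ (∩∈ (∩∈ p q) (∩∈ q r))
      ≤⟨ +-mono-≤ (monotone _ q Sum.[ proj₂ , proj₁ ])
                  (monotone _ (∩∈ p r) λ { ((x , _) , (_ , z)) → x , z }) ⟩
    μ q + μ (∩∈ p r) ∎

  -- For g ≈ h k with h ∈ Y, the triangle inequality is applied to gP, hP and P.
  deficit-power : ∀ {P} (p : Member P) δ (Y : GroupSubset G) →
    (∀ {g} → g ∈ Y → μ p ≤ μ (∩∈ (translate∈ g p) p) + δ) →
    ∀ n {g} → g ∈ power G Y n → μ p ≤ μ (∩∈ (translate∈ g p) p) + n · δ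
  deficit-power {P} p δ Y small zero {g} g≈ε =
    ≤-trans (monotone p (∩∈ (translate∈ g p) p)
              λ x∈P → translate-cong P (Group.sym G g≈ε) (proj₂ (translate-ε P) x∈P) , x∈P)
            (x≤x+y ≤-refl)
  deficit-power {P} p δ Y small (suc n) {g} (h , k , h∈Y , k∈Yⁿ , g≈hk) =
    +-cancelʳ-≤ (μ hp) (begin
      μ p + μ hp
        ≈⟨ +-congˡ (invariant h p) ⟩
      μ p + μ p
        ≤⟨ +-mono-≤ (deficit-power p δ Y small n k∈Yⁿ) (small h∈Y) ⟩
      μ (∩∈ kp p) + n · δ + (μ (∩∈ hp p) + δ)
        ≈⟨ +-congʳ (+-congʳ (invariant h (∩∈ kp p))) ⟨
      μ (translate∈ h (∩∈ kp p)) + n · δ + (μ (∩∈ hp p) + δ)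
        ≤⟨ +-monoˡ-≤ _ (+-monoˡ-≤ _ (monotone _ (∩∈ gp hp) h[kP∩P]⊆gP∩hP)) ⟩
      μ (∩∈ gp hp) + n · δ + (μ (∩∈ hp p) + δ)
        ≈⟨ +-assoc _ _ _ ⟩
      μ (∩∈ gp hp) + (n · δ + (μ (∩∈ hp p) + δ))
        ≈⟨ +-congˡ (trans (+-comm _ _) (+-assoc _ _ _)) ⟩
      μ (∩∈ gp hp) + (μ (∩∈ hp p) + suc n · δ)
        ≈⟨ +-assoc _ _ _ ⟨
      μ (∩∈ gp hp) + μ (∩∈ hp p) + suc n · δ
        ≤⟨ +-monoˡ-≤ _ (μ-∩-triangle gp hp p) ⟩
      μ hp + μ (∩∈ gp p) + suc n · δ
        ≈⟨ trans (+-assoc _ _ _) (+-comm _ _) ⟩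
      μ (∩∈ gp p) + suc n · δ + μ hp ∎)
    where
    hp = translate∈ h p
    kp = translate∈ k p
    gp = translate∈ g p

    h[kP∩P]⊆gP∩hP : translate X h (translate X k P ∩ P) ⊆ translate X g P ∩ translate X h P
    h[kP∩P]⊆gP∩hP x∈ =
      let x∈hkP , x∈hP = translate-∩⁻ h (translate X k P) P x∈
      in translate-cong P (Group.sym G g≈hk) (proj₂ (translate-∙ h k P) x∈hkP) , x∈hP

-- Large sets and their stabilizers

module Largeness {ℓ} (G : Group ℓ ℓ) where
  open Group G
  open GroupProperties G
  open Translates (leftTranslation G)

  GG : GSet G
  GG = leftTranslation G

  -- Monotonicity also carries `L` along extensional equalities `≐`, by applying it to each of the
  -- two inclusions.
  Monotone : (GroupSubset G → Set ℓ) → Set _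
  Monotone L = ∀ (C D : GroupSubset G) → C ⊆ D → L C → L D

  Meets : (GroupSubset G → Set ℓ) → Carrier → List Carrier → GroupSubset G → Set ℓ
  Meets L h hs C = Any (λ h′ → L (translate GG h′ C ∩ translate GG h C)) hs

  -- However translates of C are appended one by one to those by hs, one of the
  -- next k + 1 of them meets an earlier one in an L-set.
  Crowded : (GroupSubset G → Set ℓ) → ℕ → List Carrier → GroupSubset G → Set ℓ
  Crowded L zero    hs C = ∀ h → Meets L h hs C
  Crowded L (suc k) hs C = ∀ h → Meets L h hs C ⊎ Crowded L k (h ∷ hs) C

  -- A first-order and positive substitute for "C has measure bounded below":
  -- length ks is the number of times one can still pass from C to a large gC ∩ C.
  Large : List ℕ → GroupSubset G → Set ℓ
  Large []       C = ∃ λ x → x ∈ C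
  Large (k ∷ ks) C = ∀ h → Crowded (Large ks) k (h ∷ []) C

  Meets-mono : ∀ {L} → Monotone L → ∀ h hs → Monotone (Meets L h hs)
  Meets-mono mono h hs C D C⊆D = Any.map λ {h′} →
    mono (translate GG h′ C ∩ translate GG h C) (translate GG h′ D ∩ translate GG h D)
      λ { (x∈ , x∈′) → translate-mono h′ C D C⊆D x∈ , translate-mono h C D C⊆D x∈′ }

  Crowded-mono : ∀ {L} → Monotone L → ∀ k hs → Monotone (Crowded L k hs)
  Crowded-mono mono zero    hs C D C⊆D cr h = Meets-mono mono h hs C D C⊆D (cr h)
  Crowded-mono mono (suc k) hs C D C⊆D cr h =
    Sum.map (Meets-mono mono h hs C D C⊆D) (Crowded-mono mono k (h ∷ hs) C D C⊆D) (cr h)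

  Large-mono : ∀ ks → Monotone (Large ks)
  Large-mono []       C D C⊆D (x , x∈C) = x , C⊆D x∈C
  Large-mono (k ∷ ks) C D C⊆D large h = Crowded-mono (Large-mono ks) k (h ∷ []) C D C⊆D (large h)

  -- Since h(gC) = (hg)C, translating the set multiplies the list on the right by `g`. The universal
  -- quantifiers over `h` in `Crowded` and `Large` then absorb `g`, which makes `Large` translation
  -- invariant.
  Meets-translate : ∀ {L} → Monotone L → ∀ g h hs (C : GroupSubset G) →
    Meets L (h ∙ g) (map (_∙ g) hs) C → Meets L h hs (translate GG g C)
  Meets-translate mono g h hs C = Any.map (λ {h′} →
    mono (translate GG (h′ ∙ g) C ∩ translate GG (h ∙ g) C)
         (translate GG h′ (translate GG g C) ∩ translate GG h (translate GG g C))
         λ { (x∈ , x∈′) → proj₁ (translate-∙ h′ g C) x∈ , proj₁ (translate-∙ h g C) x∈′ }) ∘ Any.map⁻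

  Crowded-translate : ∀ {L} → Monotone L → ∀ k g hs (C : GroupSubset G) →
    Crowded L k (map (_∙ g) hs) C → Crowded L k hs (translate GG g C)
  Crowded-translate mono zero    g hs C cr h = Meets-translate mono g h hs C (cr (h ∙ g))
  Crowded-translate mono (suc k) g hs C cr h =
    Sum.map (Meets-translate mono g h hs C) (Crowded-translate mono k g (h ∷ hs) C) (cr (h ∙ g))

  Large-translate : ∀ ks g (C : GroupSubset G) → Large ks C → Large ks (translate GG g C)
  Large-translate []       g C (x , x∈C) = g ∙ x , translate-∈ g C x∈C
  Large-translate (k ∷ ks) g C large h =
    Crowded-translate (Large-mono ks) k g (h ∷ []) C (large (h ∙ g))

  Large-untranslate : ∀ ks g (C : GroupSubset G) → Large ks (translate GG g C) → Large ks C
  Large-untranslate ks g C large =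
    Large-mono ks (translate GG (g ⁻¹) (translate GG g C)) C
      (λ x∈ → proj₁ (translate-ε C) (translate-cong C (inverseˡ g) (proj₂ (translate-∙ (g ⁻¹) g C) x∈)))
      (Large-translate ks (g ⁻¹) (translate GG g C) large)

  -- Offering `ε` as the new translate in every round must sooner or later produce the pair.
  Crowded⇒pair : ∀ {L} k hs (C : GroupSubset G) → Crowded L k hs C →
    ∃ λ h′ → ∃ λ h → L (translate GG h′ C ∩ translate GG h C)
  Crowded⇒pair zero    hs C cr = let h′ , l = Any.satisfied (cr ε) in h′ , ε , l
  Crowded⇒pair (suc k) hs C cr with cr ε
  ... | inj₁ meets = let h′ , l = Any.satisfied meets in h′ , ε , l
  ... | inj₂ cr′   = Crowded⇒pair k (ε ∷ hs) C cr′

  Large-tail : ∀ k ks (C : GroupSubset G) → Large (k ∷ ks) C → Large ks C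
  Large-tail k ks C large with Crowded⇒pair k (ε ∷ []) C (large ε)
  ... | h′ , h , l =
    Large-untranslate ks h C (Large-mono ks (translate GG h′ C ∩ translate GG h C) (translate GG h C) proj₂ l)

  Large⇒nonempty : ∀ ks (C : GroupSubset G) → Large ks C → ∃ λ x → x ∈ C
  Large⇒nonempty []       C large = large
  Large⇒nonempty (k ∷ ks) C large = Large⇒nonempty ks C (Large-tail k ks C large)

  -- A maximality argument: extend `hs` by any `h` whose translate meets no earlier one in an
  -- `L`-set. `Crowded` bounds the number of such extensions, and where none is possible the current
  -- list serves for every `x`.
  Crowded⇒cover : (∀ {a} → ExcludedMiddle a) → ∀ {L} k hs (C : GroupSubset G) → Crowded L k hs C →
    ∃ λ gs → ∀ x → Meets L x gs C
  Crowded⇒cover em zero hs C cr = hs , cr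
  Crowded⇒cover em {L} (suc k) hs C cr with em {P = ∃ λ h → ¬ Meets L h hs C}
  ... | no  none = hs , λ x → decidable-stable em λ ¬meets → none (x , ¬meets)
  ... | yes (h , ¬meets) with cr h
  ...   | inj₁ meets = contradiction meets ¬meets
  ...   | inj₂ cr′   = Crowded⇒cover em k (h ∷ hs) C cr′

  LargeStabilizer : List ℕ → GroupSubset G → GroupSubset G
  LargeStabilizer ks C = record
    { member   = λ x → Large ks (translate GG x C ∩ C)
    ; respects = λ {x} {y} x≈y → Large-mono ks (translate GG x C ∩ C) (translate GG y C ∩ C)
                   λ { (z∈xC , z∈C) → translate-cong C x≈y z∈xC , z∈C }
    }

  -- Translation by g⁻¹ takes gC ∩ hC to C ∩ g⁻¹hC. With `h = x` this yields covering by translates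
  -- of the stabilizer, with `h = ε` closure under inversion.
  LargeStabilizer-∋ : ∀ ks g h (C : GroupSubset G) →
    Large ks (translate GG g C ∩ translate GG h C) → g ⁻¹ ∙ h ∈ LargeStabilizer ks C
  LargeStabilizer-∋ ks g h C large =
    Large-untranslate ks g (translate GG (g ⁻¹ ∙ h) C ∩ C)
      (Large-mono ks (translate GG g C ∩ translate GG h C) (translate GG g (translate GG (g ⁻¹ ∙ h) C ∩ C))
        (λ { (x∈gC , x∈hC) → translate-∩⁺ g (translate GG (g ⁻¹ ∙ h) C) C
               ( proj₁ (translate-∙ g (g ⁻¹ ∙ h) C) (translate-cong C (sym (\\-leftDividesˡ g h)) x∈hC)
               , x∈gC ) })
        large)

  -- The entry `k` is spent here: it bounds a maximal list of translates of C without `ks`-large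
  -- pairwise intersections, and the elements of that list translate the stabilizer so as to cover
  -- G.
  LargeStabilizer-generic : (∀ {a} → ExcludedMiddle a) → ∀ k ks (C : GroupSubset G) → Large (k ∷ ks) C →
    Generic G (LargeStabilizer ks C)
  LargeStabilizer-generic em k ks C large =
    let gs , cover = Crowded⇒cover em k (ε ∷ []) C (large ε)
    in gs , λ x → Any.map (λ {g} l → g ⁻¹ ∙ x , LargeStabilizer-∋ ks g x C l , sym (\\-leftDividesˡ g x)) (cover x)

  LargeStabilizer-symmetric : ∀ ks (C : GroupSubset G) → Large ks C →
    SymmetricSet G (LargeStabilizer ks C)
  LargeStabilizer-symmetric ks C large =
    Large-mono ks C (translate GG ε C ∩ C) (λ x∈C → proj₂ (translate-ε C) x∈C , x∈C) large ,
    λ {x} l → Subset.respects (LargeStabilizer ks C) (identityʳ (x ⁻¹))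
      (LargeStabilizer-∋ ks x ε C
        (Large-mono ks (translate GG x C ∩ C) (translate GG x C ∩ translate GG ε C)
          (λ { (y∈xC , y∈C) → y∈xC , proj₂ (translate-ε C) y∈C }) l))

-- Positive definability

module Definability {ℓ} (G : Group ℓ ℓ) (B : GroupSubset G) where
  open Group G
  open Translates (leftTranslation G)
  open Largeness G

  ⋂[_]B : List Carrier → GroupSubset G
  ⋂[ gs ]B = ⋂-translates G B gs

  translate-⋂ : ∀ h gs → translate GG h ⋂[ gs ]B ≐ ⋂[ map (h ∙_) gs ]B
  translate-⋂ h gs =
    (λ x∈ → All.map⁺ (All.map (λ {g} y∈gB → proj₂ (translate-∙ h g B)
                (translate⁺ h (translate GG g B) y∈gB)) (translate⁻ h ⋂[ gs ]B x∈))) ,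
    (λ all → translate⁺ h ⋂[ gs ]B (All.map (λ {g} x∈hgB →
                translate⁻ h (translate GG g B) (proj₁ (translate-∙ h g B) x∈hgB)) (All.map⁻ all)))

  translate-∩-translate-⋂ : ∀ h h′ gs →
    translate GG h ⋂[ gs ]B ∩ translate GG h′ ⋂[ gs ]B ≐ ⋂[ map (h ∙_) gs ++ map (h′ ∙_) gs ]B
  translate-∩-translate-⋂ h h′ gs =
    (λ { (x∈ , x∈′) → All.++⁺ (proj₁ (translate-⋂ h gs) x∈) (proj₁ (translate-⋂ h′ gs) x∈′) }) ,
    (λ all → proj₂ (translate-⋂ h gs) (All.++⁻ˡ (map (h ∙_) gs) all)
           , proj₂ (translate-⋂ h′ gs) (All.++⁻ʳ (map (h ∙_) gs) all))

  translate-∩-⋂ : ∀ h gs → translate GG h ⋂[ gs ]B ∩ ⋂[ gs ]B ≐ ⋂[ map (h ∙_) gs ++ gs ]B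
  translate-∩-⋂ h gs =
    (λ { (x∈ , x∈′) → All.++⁺ (proj₁ (translate-⋂ h gs) x∈) x∈′ }) ,
    (λ all → proj₂ (translate-⋂ h gs) (All.++⁻ˡ (map (h ∙_) gs) all)
           , All.++⁻ʳ (map (h ∙_) gs) all)

  Definable : ∀ n → (Vec Carrier n → Set ℓ) → Set ℓ
  Definable n P = Σ (PositiveFormula n) λ φ → ∀ ρ → P ρ ⇔ Satisfies G B φ ρ

  definable-resp : ∀ {n} {P Q : Vec Carrier n → Set ℓ} →
    (∀ ρ → Q ρ ⇔ P ρ) → Definable n P → Definable n Q
  definable-resp Q⇔P (φ , P⇔φ) = φ , λ ρ → P⇔φ ρ ⇔-∘ Q⇔P ρ

  definable-⊎ : ∀ {n} {P Q : Vec Carrier n → Set ℓ} →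
    Definable n P → Definable n Q → Definable n (λ ρ → P ρ ⊎ Q ρ)
  definable-⊎ (φ , P⇔φ) (ψ , Q⇔ψ) = (φ ∨ᶠ ψ) , λ ρ → P⇔φ ρ ⊎-⇔ Q⇔ψ ρ

  definable-∃ : ∀ {n} {P : Carrier → Vec Carrier n → Set ℓ} →
    Definable (suc n) (λ ρ → P (head ρ) (tail ρ)) → Definable n (λ ρ → ∃ λ x → P x ρ)
  definable-∃ (φ , P⇔φ) = ∃ᶠ φ , λ ρ → mk⇔
    (λ { (x , p) → x , Equivalence.to (P⇔φ (x ∷ ρ)) p })
    (λ { (x , s) → x , Equivalence.from (P⇔φ (x ∷ ρ)) s })

  definable-∀ : ∀ {n} {P : Carrier → Vec Carrier n → Set ℓ} →
    Definable (suc n) (λ ρ → P (head ρ) (tail ρ)) → Definable n (λ ρ → ∀ x → P x ρ)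
  definable-∀ (φ , P⇔φ) = ∀ᶠ φ , λ ρ → mk⇔
    (λ p x → Equivalence.to (P⇔φ (x ∷ ρ)) (p x))
    (λ s x → Equivalence.from (P⇔φ (x ∷ ρ)) (s x))

  evaluates : ∀ {n} → List (Term n) → Vec Carrier n → List Carrier
  evaluates ts ρ = map (λ t → evaluate G t ρ) ts

  weaken : ∀ {n} → Term n → Term (suc n)
  weaken (var i)  = var (suc i)
  weaken 1ᵗ       = 1ᵗ
  weaken (s ·ᵗ t) = weaken s ·ᵗ weaken t
  weaken (invᵗ t) = invᵗ (weaken t)

  evaluate-weaken : ∀ {n} (t : Term n) ρ → evaluate G (weaken t) ρ ≡ evaluate G t (tail ρ)
  evaluate-weaken (var i)  (x ∷ ρ) = ≡.refl
  evaluate-weaken 1ᵗ       ρ = ≡.refl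
  evaluate-weaken (s ·ᵗ t) ρ = ≡.cong₂ _∙_ (evaluate-weaken s ρ) (evaluate-weaken t ρ)
  evaluate-weaken (invᵗ t) ρ = ≡.cong _⁻¹ (evaluate-weaken t ρ)

  evaluates-weaken : ∀ {n} (ts : List (Term n)) ρ → evaluates (map weaken ts) ρ ≡ evaluates ts (tail ρ)
  evaluates-weaken ts ρ = ≡.trans (≡.sym (map-∘ ts)) (map-cong (λ t → evaluate-weaken t ρ) ts)

  evaluates-· : ∀ {n} (t : Term n) ts ρ → evaluates (map (t ·ᵗ_) ts) ρ ≡ map (evaluate G t ρ ∙_) (evaluates ts ρ)
  evaluates-· t ts ρ = ≡.trans (≡.sym (map-∘ ts)) (map-∘ ts)

  definable-⋂ : ∀ {n} (ts : List (Term n)) → Definable (suc n) (λ ρ → head ρ ∈ ⋂[ evaluates ts (tail ρ) ]B)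
  -- The empty intersection is all of G, so the formula has to be a tautology.
  definable-⋂ [] = 1ᵗ ≈ᶠ 1ᵗ , λ ρ → mk⇔ (λ _ → refl) (λ _ → [])
  definable-⋂ (t ∷ ts) with definable-⋂ ts
  -- Membership of x in gB is expressed without a quantifier, as g⁻¹x ∈ B.
  ... | φ , ∈⋂⇔φ = (predicate (invᵗ (weaken t) ·ᵗ var zero) ∧ᶠ φ) , λ { ρ@(x ∷ xs) →
    (translated-⇔ ρ ×-⇔ ∈⋂⇔φ ρ) ⇔-∘ mk⇔ (λ { (p ∷ ps) → p , ps }) (λ { (p , ps) → p ∷ ps }) }
    where
    translated-⇔ : ∀ ρ → head ρ ∈ translate GG (evaluate G t (tail ρ)) B ⇔
                         evaluate G (weaken t) ρ ⁻¹ ∙ evaluate G (var zero) ρ ∈ B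
    translated-⇔ ρ@(x ∷ xs) rewrite evaluate-weaken t ρ =
      mk⇔ (translate⁻ (evaluate G t xs) B) (translate⁺ (evaluate G t xs) B)

  -- The list is nonempty because an empty disjunction is falsity, which no positive formula
  -- expresses in general: if G is trivial and B = G, all positive formulas hold. This fits `Large`,
  -- whose lists start as `h ∷ []`.
  definable-Any : ∀ {n} {P : Carrier → Vec Carrier n → Set ℓ} →
    (∀ t → Definable n (λ ρ → P (evaluate G t ρ) ρ)) →
    ∀ t ts → Definable n (λ ρ → Any (λ x → P x ρ) (evaluates (t ∷ ts) ρ))
  definable-Any def t [] = definable-resp (λ ρ → mk⇔ (λ { (here p) → p ; (there ()) }) here) (def t)
  definable-Any def t (u ∷ us) =
    definable-resp (λ ρ → mk⇔ (λ { (here p) → inj₁ p ; (there q) → inj₂ q }) Sum.[ here , there ])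
      (definable-⊎ (def t) (definable-Any def u us))

  -- Arbitrary term lists in any number of variables are the right generality for induction on `ks`:
  -- passing to an intersection of two translates gives again some `⋂[_]B`, but its translating
  -- elements now involve the newly bound variables.
  DefinableOn⋂ : (GroupSubset G → Set ℓ) → Set ℓ
  DefinableOn⋂ L = ∀ {n} (ts : List (Term n)) → Definable n (λ ρ → L ⋂[ evaluates ts ρ ]B)

  module _ {L : GroupSubset G → Set ℓ} (mono : Monotone L) (def : DefinableOn⋂ L) where

    definable-∩ : ∀ {n} (t u : Term n) ts → Definable n λ ρ →
      L (translate GG (evaluate G t ρ) ⋂[ evaluates ts ρ ]B ∩ translate GG (evaluate G u ρ) ⋂[ evaluates ts ρ ]B)
    definable-∩ t u ts = definable-resp respects (def (map (t ·ᵗ_) ts ++ map (u ·ᵗ_) ts))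
      where
      lists : ∀ ρ → evaluates (map (t ·ᵗ_) ts ++ map (u ·ᵗ_) ts) ρ ≡
        map (evaluate G t ρ ∙_) (evaluates ts ρ) ++ map (evaluate G u ρ ∙_) (evaluates ts ρ)
      lists ρ = ≡.trans (map-++ _ (map (t ·ᵗ_) ts) (map (u ·ᵗ_) ts))
        (≡.cong₂ _++_ (evaluates-· t ts ρ) (evaluates-· u ts ρ))

      respects : ∀ ρ →
        L (translate GG (evaluate G t ρ) ⋂[ evaluates ts ρ ]B ∩ translate GG (evaluate G u ρ) ⋂[ evaluates ts ρ ]B) ⇔
        L ⋂[ evaluates (map (t ·ᵗ_) ts ++ map (u ·ᵗ_) ts) ρ ]B
      respects ρ rewrite lists ρ =
        let g = evaluate G t ρ
            h = evaluate G u ρ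
            gs = evaluates ts ρ
            C = translate GG g ⋂[ gs ]B ∩ translate GG h ⋂[ gs ]B
            D = ⋂[ map (g ∙_) gs ++ map (h ∙_) gs ]B
        in mk⇔ (mono C D (proj₁ (translate-∩-translate-⋂ g h gs)))
               (mono D C (proj₂ (translate-∩-translate-⋂ g h gs)))

    definable-Meets : ∀ {n} (u t : Term n) us ts → Definable n λ ρ →
      Meets L (evaluate G u ρ) (evaluates (t ∷ us) ρ) ⋂[ evaluates ts ρ ]B
    definable-Meets u t us ts = definable-Any (λ v → definable-∩ v u ts) t us

    definable-Meets-weakened : ∀ {n} (t : Term n) us ts → Definable (suc n) λ ρ →
      Meets L (head ρ) (evaluates (t ∷ us) (tail ρ)) ⋂[ evaluates ts (tail ρ) ]B
    definable-Meets-weakened t us ts =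
      definable-resp (λ { ρ@(x ∷ xs) → respects ρ })
        (definable-Meets (var zero) (weaken t) (map weaken us) (map weaken ts))
      where
      respects : ∀ ρ → Meets L (head ρ) (evaluates (t ∷ us) (tail ρ)) ⋂[ evaluates ts (tail ρ) ]B ⇔
        Meets L (evaluate G (var zero) ρ) (evaluates (map weaken (t ∷ us)) ρ) ⋂[ evaluates (map weaken ts) ρ ]B
      respects ρ@(x ∷ xs) rewrite evaluates-weaken (t ∷ us) ρ | evaluates-weaken ts ρ =
        mk⇔ (λ p → p) (λ p → p)

    definable-Crowded : ∀ k {n} (t : Term n) us ts → Definable n λ ρ →
      Crowded L k (evaluates (t ∷ us) ρ) ⋂[ evaluates ts ρ ]B
    definable-Crowded zero    t us ts = definable-∀ (definable-Meets-weakened t us ts)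
    definable-Crowded (suc k) t us ts = definable-∀ (definable-⊎ (definable-Meets-weakened t us ts)
      (definable-resp (λ { ρ@(x ∷ xs) → respects ρ })
        (definable-Crowded k (var zero) (map weaken (t ∷ us)) (map weaken ts))))
      where
      respects : ∀ ρ → Crowded L k (head ρ ∷ evaluates (t ∷ us) (tail ρ)) ⋂[ evaluates ts (tail ρ) ]B ⇔
        Crowded L k (evaluate G (var zero) ρ ∷ evaluates (map weaken (t ∷ us)) ρ) ⋂[ evaluates (map weaken ts) ρ ]B
      respects ρ@(x ∷ xs) rewrite evaluates-weaken (t ∷ us) ρ | evaluates-weaken ts ρ =
        mk⇔ (λ p → p) (λ p → p)

  definable-Large : ∀ ks → DefinableOn⋂ (Large ks)
  definable-Large []       ts = definable-∃ (definable-⋂ ts)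
  definable-Large (k ∷ ks) ts =
    definable-∀ (definable-resp (λ { ρ@(x ∷ xs) → respects ρ })
      (definable-Crowded (Large-mono ks) (definable-Large ks) k (var zero) [] (map weaken ts)))
    where
    respects : ∀ ρ → Crowded (Large ks) k (head ρ ∷ []) ⋂[ evaluates ts (tail ρ) ]B ⇔
      Crowded (Large ks) k (evaluate G (var zero) ρ ∷ []) ⋂[ evaluates (map weaken ts) ρ ]B
    respects ρ@(x ∷ xs) rewrite evaluates-weaken ts ρ = mk⇔ (λ p → p) (λ p → p)

  LargeStabilizer-definable : ∀ ks gs → PositivelyDefinable G B (LargeStabilizer ks ⋂[ gs ]B)
  LargeStabilizer-definable ks gs =
    length gs , proj₁ definable , parameters , λ x → proj₂ definable (x ∷ parameters) ⇔-∘ respects x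
    where
    parameters : Vec Carrier (length gs)
    parameters = Vec.tabulate (List.lookup gs)

    ts : List (Term (suc (length gs)))
    ts = tabulate (λ i → var (suc i))

    evaluates-ts : ∀ x → evaluates ts (x ∷ parameters) ≡ gs
    evaluates-ts x = ≡.trans (map-tabulate (λ i → var (suc i)) _)
      (≡.trans (tabulate-cong (lookup∘tabulate (List.lookup gs))) (tabulate-lookup gs))

    definable : Definable (suc (length gs)) λ ρ → Large ks
      (translate GG (evaluate G (var zero) ρ) ⋂[ evaluates ts ρ ]B ∩ translate GG (evaluate G 1ᵗ ρ) ⋂[ evaluates ts ρ ]B)
    -- The entries of `gs` are the parameters and variable zero is the element tested; the
    -- untranslated copy of C is written as its translate by `1ᵗ` so that `definable-∩` applies.
    definable = definable-∩ (Large-mono ks) (definable-Large ks) (var zero) 1ᵗ ts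

    respects : ∀ x → x ∈ LargeStabilizer ks ⋂[ gs ]B ⇔ Large ks
      (translate GG x ⋂[ evaluates ts (x ∷ parameters) ]B ∩ translate GG ε ⋂[ evaluates ts (x ∷ parameters) ]B)
    respects x rewrite evaluates-ts x =
      let C = ⋂[ gs ]B in mk⇔
        (Large-mono ks (translate GG x C ∩ C) (translate GG x C ∩ translate GG ε C)
          λ { (y∈xC , y∈C) → y∈xC , proj₂ (translate-ε C) y∈C })
        (Large-mono ks (translate GG x C ∩ translate GG ε C) (translate GG x C ∩ C)
          λ { (y∈xC , y∈C) → y∈xC , proj₁ (translate-ε C) y∈C })

-- Sets of positive measure are large

module MeasureLarge (em : ∀ {a} → ExcludedMiddle a) (ℝ : CompleteOrderedField)
  {ℓ d} {G : Group ℓ ℓ} {𝒟 : GLattice (leftTranslation G) d} (mean : Mean (leftTranslation G) ℝ 𝒟) where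
  open CompleteOrderedField ℝ
  open OrderedField em ℝ
  open PartialOrderReasoning poset
  open GLattice 𝒟
  open MeanProperties em ℝ mean
  open Largeness G
  private module G = Group G

  ⋃-translates : List G.Carrier → GroupSubset G → GroupSubset G
  ⋃-translates hs C = foldr (λ h U → translate GG h C ∪ U) ∅ hs

  ⋃-translates∈ : ∀ hs {C} → Member C → Member (⋃-translates hs C)
  ⋃-translates∈ []       c = ∅∈
  ⋃-translates∈ (h ∷ hs) c = ∪∈ (translate∈ h c) (⋃-translates∈ hs c)

  μ-⋃-∩-≤ : ∀ {C D δ} (c : Member C) (e : Member D) hs →
    All (λ h → μ (∩∈ (translate∈ h c) e) ≤ δ) hs → μ (∩∈ (⋃-translates∈ hs c) e) ≤ length hs · δ
  μ-⋃-∩-≤ c e [] [] = ≤-trans (monotone _ ∅∈ proj₁) (≤-reflexive mean-∅)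
  μ-⋃-∩-≤ {δ = δ} c e (h ∷ hs) (small ∷ smalls) = begin
    μ (∩∈ (∪∈ hc U) e)
      ≤⟨ monotone _ (∪∈ (∩∈ hc e) (∩∈ U e))
           (λ { (inj₁ x , z) → inj₁ (x , z) ; (inj₂ y , z) → inj₂ (y , z) }) ⟩
    μ (∪∈ (∩∈ hc e) (∩∈ U e))
      ≤⟨ μ-∪-≤ (∩∈ hc e) (∩∈ U e) ⟩
    μ (∩∈ hc e) + μ (∩∈ U e)
      ≤⟨ +-mono-≤ small (μ-⋃-∩-≤ c e hs smalls) ⟩
    δ + length hs · δ ∎
    where
    hc = translate∈ h c
    U  = ⋃-translates∈ hs c

  -- As long as no two chosen translates meet in an L-set, each new one adds at least
  -- u to the measure of the union, which exceeds μ(G) after K steps.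
  measure⇒Crowded : ∀ {L K u δ} →
    (∀ {D} (e : Member D) → δ ≤ μ e → L D) →
    0# ≤ δ → K · δ ≤ u → μ full∈ < K · u →
    ∀ {C} (c : Member C) → u + u ≤ μ c →
    ∀ k hs → k ℕ.+ length hs ≡ K → length hs · u ≤ μ (⋃-translates∈ hs c) → Crowded L k hs C
  measure⇒Crowded δ≤μ⇒L 0≤δ Kδ≤u μG<Ku c 2u≤μc zero hs ≡.refl hsu≤μ =
    contradiction (≤-trans hsu≤μ (monotone _ full∈ _)) (<⇒≱ μG<Ku)
  measure⇒Crowded {u = u} {δ} δ≤μ⇒L 0≤δ Kδ≤u μG<Ku c 2u≤μc (suc k) hs ≡.refl hsu≤μ h
    with em {P = Any (λ h′ → δ ≤ μ (∩∈ (translate∈ h′ c) (translate∈ h c))) hs}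
  ... | yes meets = inj₁ (Any.map (λ {h′} → δ≤μ⇒L (∩∈ (translate∈ h′ c) (translate∈ h c))) meets)
  ... | no ¬meets = inj₂ (measure⇒Crowded δ≤μ⇒L 0≤δ Kδ≤u μG<Ku c 2u≤μc k (h ∷ hs)
                            (ℕ.+-suc k (length hs)) (+-cancelʳ-≤ u (begin
    u + length hs · u + u
      ≈⟨ trans (+-comm _ _) (sym (+-assoc _ _ _)) ⟩
    u + u + length hs · u
      ≤⟨ +-mono-≤ 2u≤μc hsu≤μ ⟩
    μ c + μ U
      ≈⟨ +-congʳ (invariant h c) ⟨
    μ hc + μ U
      ≈⟨ μ-∪-∩ hc U ⟨
    μ (∪∈ hc U) + μ (∩∈ hc U)
      ≤⟨ +-mono-≤ ≤-refl (monotone _ (∩∈ U hc) λ { (x , y) → y , x }) ⟩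
    μ (∪∈ hc U) + μ (∩∈ U hc)
      ≤⟨ +-mono-≤ ≤-refl (μ-⋃-∩-≤ c hc hs (All.map (proj₁ ∘ ≰⇒>) (All.¬Any⇒All¬ hs ¬meets))) ⟩
    μ (∪∈ hc U) + length hs · δ
      -- One of the two copies of `u` in `μ c` pays for all overlaps: at most K earlier translates,
      -- each overlapping the new one in measure at most `δ`.
      ≤⟨ +-mono-≤ ≤-refl (≤-trans (·-monoˡ-≤ 0≤δ (ℕ.m≤n+m (length hs) (suc k))) Kδ≤u) ⟩
    μ (∪∈ hc U) + u ∎)))
    where
    hc = translate∈ h c
    U  = ⋃-translates∈ hs c

  -- The list `ks` depends on `n` and `t` only and is found before C. This uniformity drives the
  -- induction, since all intersections of measure at least `δ` have to be large for the same tail.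
  measure⇒Large : ∀ n {t} → 0# < t →
    ∃ λ ks → length ks ≡ n × (∀ {C} (c : Member C) → t ≤ μ c → Large ks C)
  measure⇒Large zero {t} 0<t = [] , ≡.refl , λ c t≤μc →
    μ-positive⇒nonempty c (begin-strict 0# <⟨ 0<t ⟩ t ≤⟨ t≤μc ⟩ μ c ∎)
  measure⇒Large (suc n) {t} 0<t =
    -- With K = `suc k`: u = t/2, K u exceeds the measure of G, and δ = u/K. The list `h ∷ []`
    -- already accounts for one of the K translates, so `k` remain to be appended.
    let u , 0<u , 2u≈t     = divide 0<t 1
        k , μG<ku          = archimedean 0<u (μ full∈)
        δ , 0<δ , Kδ≈u     = divide 0<u k
        ks , len , large   = measure⇒Large n 0<δ
        μG<Ku = begin-strict
          μ full∈   <⟨ μG<ku ⟩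
          k · u     ≤⟨ ·-monoˡ-≤ (proj₁ 0<u) (ℕ.n≤1+n k) ⟩
          suc k · u ∎
        u+u≈t = trans (+-congˡ (sym (+-identityʳ u))) 2u≈t
    in k ∷ ks , ≡.cong suc len , λ c t≤μc h →
      let 2u≤μc = ≤-trans (≤-reflexive u+u≈t) t≤μc
      in measure⇒Crowded large (proj₁ 0<δ) (≤-reflexive Kδ≈u) μG<Ku c 2u≤μc k (h ∷ []) (ℕ.+-comm k 1) (begin
        u + 0#                       ≤⟨ +-mono-≤ ≤-refl (proj₁ 0<u) ⟩
        u + u                        ≤⟨ 2u≤μc ⟩
        μ c                          ≈⟨ invariant h c ⟨
        μ (translate∈ h c)           ≤⟨ monotone _ _ inj₁ ⟩
        μ (⋃-translates∈ (h ∷ []) c) ∎)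

-- The descent on m(CA)

module Descent (em : ∀ {a} → ExcludedMiddle a) (ℝ : CompleteOrderedField)
  {ℓ d} {G : Group ℓ ℓ} {X : GSet G} {𝒟 : GLattice X d} (mean : Mean X ℝ 𝒟)
  (A : SubsetOf X) (B : GroupSubset G)
  (B'A∈𝒟 : ∀ B' → FiniteIntersection G B B' → product X B' A ∈ᴸ 𝒟) where
  open CompleteOrderedField ℝ
  open OrderedField em ℝ
  open PartialOrderReasoning poset
  open MeanProperties em ℝ mean
  open Largeness G
  open Definability G B
  open GLattice 𝒟
  open Translates X
  private module G = Group G

  ⋂A∈𝒟 : ∀ (gs : List⁺ G.Carrier) → product X ⋂[ toList gs ]B A ∈ᴸ 𝒟
  ⋂A∈𝒟 gs = B'A∈𝒟 ⋂[ toList gs ]B (gs , (λ x∈ → x∈) , (λ x∈ → x∈))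

  [_▹_∩] : G.Carrier → List⁺ G.Carrier → List⁺ G.Carrier
  [ g ▹ gs ∩] = List⁺.map (g G.∙_) gs ⁺++⁺ gs

  -- Minimality is tested against `ks` only, while C is large for `k ∷ ks`; the reserved entry `k`
  -- makes the stabilizer for `ks` generic.
  record AlmostMinimal (δ : Carrier) : Set ℓ where
    field
      gs      : List⁺ G.Carrier
      k       : ℕ
      ks      : List ℕ
      large   : Large (k ∷ ks) ⋂[ toList gs ]B
      ⊆B      : ⋂[ toList gs ]B ⊆ B
      minimal : ∀ {g} → g ∈ LargeStabilizer ks ⋂[ toList gs ]B →
                μ (⋂A∈𝒟 gs) ≤ μ (⋂A∈𝒟 [ g ▹ gs ∩]) + δ

  -- The invariant m(CA) < `length ks · δ` survives each step, because one entry is spent and more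
  -- than `δ` is lost. For empty `ks` it would say m(CA) < 0.
  descend : ∀ δ gs ks → Large ks ⋂[ toList gs ]B → ⋂[ toList gs ]B ⊆ B →
    μ (⋂A∈𝒟 gs) < length ks · δ → AlmostMinimal δ
  descend δ gs [] large ⊆B μ<0 = contradiction (nonNeg (⋂A∈𝒟 gs)) (<⇒≱ μ<0)
  descend δ gs (k ∷ ks) large ⊆B μ<
    with em {P = ∃ λ g → g ∈ LargeStabilizer ks ⋂[ toList gs ]B ×
                         ¬ (μ (⋂A∈𝒟 gs) ≤ μ (⋂A∈𝒟 [ g ▹ gs ∩]) + δ)}
  ... | no  none = record
    { gs = gs ; k = k ; ks = ks ; large = large ; ⊆B = ⊆B
    ; minimal = λ g∈ → decidable-stable em λ ≰ → none (_ , g∈ , ≰) }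
  ... | yes (g , g∈ , ≰) = descend δ [ g ▹ gs ∩] ks
    (Large-mono ks (translate GG g C ∩ C) ⋂[ toList [ g ▹ gs ∩] ]B (proj₁ (translate-∩-⋂ g (toList gs))) g∈)
    (λ x∈ → ⊆B (proj₂ (proj₂ (translate-∩-⋂ g (toList gs)) x∈)))
    (+-cancelʳ-< δ (begin-strict
      μ (⋂A∈𝒟 [ g ▹ gs ∩]) + δ <⟨ ≰⇒> ≰ ⟩
      μ (⋂A∈𝒟 gs)              <⟨ μ< ⟩
      δ + length ks · δ        ≈⟨ +-comm _ _ ⟩
      length ks · δ + δ        ∎))
    where C = ⋂[ toList gs ]B

  -- (gC ∩ C)A is contained in gCA ∩ CA, so a small loss in passing from C to gC ∩ C makes `g`
  -- almost stabilize CA.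
  stabilizes : ∀ gs g →
    μ (⋂A∈𝒟 [ g ▹ gs ∩]) ≤ μ (∩∈ (translate∈ g (⋂A∈𝒟 gs)) (⋂A∈𝒟 gs))
  stabilizes gs g = monotone _ _ λ x∈ →
    product-translate g C A (product-mono D (translate GG g C) A (proj₁ ∘ split) x∈) ,
    product-mono D C A (proj₂ ∘ split) x∈
    where
    C = ⋂[ toList gs ]B
    D = ⋂[ toList [ g ▹ gs ∩] ]B
    split = proj₂ (translate-∩-⋂ g (toList gs))

-- Choice of constants and conclusion

proposition3p11 : (∀ {a} → ExcludedMiddle a) →
    ∀ {ℓ d : Level} (ℝ : CompleteOrderedField) (G : Group ℓ ℓ) (X : GSet G) →
    let open CompleteOrderedField ℝ in
    (A : SubsetOf X) (B : GroupSubset G) (N : ℕ)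
    (𝒟 : GLattice X d)
    (A∈𝒟 : A ∈ᴸ 𝒟)
    (B'A∈𝒟 : ∀ B' → FiniteIntersection G B B' → product X B' A ∈ᴸ 𝒟)
    (m : Mean X ℝ 𝒟) → 0# < Mean.value m A∈𝒟 →
    (m' : Mean (leftTranslation G) ℝ (translateLattice G B)) →
    0# < Mean.value m' (self∈translateLattice G B) →
    ∃ λ (Y : GroupSubset G) →
    Generic G Y × SymmetricSet G Y × PositivelyDefinable G B Y ×
    (∀ {g} → g ∈ power G Y N → St X ℝ 𝒟 m 1# (B'A∈𝒟 B (self-intersection G B)) g)
proposition3p11 em ℝ G X A B N 𝒟 A∈𝒟 B'A∈𝒟 m 0<mA m' 0<m'B =
  Y , LargeStabilizer-generic em k ks C large ,
  LargeStabilizer-symmetric ks C (Large-tail k ks C large) ,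
  LargeStabilizer-definable ks (toList gs) ,
  λ {g} g∈Yᴺ → begin-strict
    -- For ε = 1 the threshold in `St` vanishes, so positivity is all that has to be shown.
    (1# - 1#) * μ BA                      ≈⟨ trans (*-congʳ (-‿inverseʳ 1#)) (zeroˡ _) ⟩
    0#                                    <⟨ positive g∈Yᴺ ⟩
    μ (∩∈ (translate∈ g CA) CA)           ≤⟨ monotone _ _ (CA∩⊆BA∩ g) ⟩
    μ (∩∈ (translate∈ g BA) BA)           ∎
  where
  open CompleteOrderedField ℝ
  open OrderedField em ℝ
  open PartialOrderReasoning poset
  open MeanProperties em ℝ m
  open GLattice 𝒟
  open Largeness G
  open Definability G B
  open Descent em ℝ m A B B'A∈𝒟
  open Translates X

  BA : Member (product X B A)
  BA = B'A∈𝒟 B (self-intersection G B)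

  δ : Carrier
  -- (N+1)δ = m(A), so that N losses of `δ` still leave `δ`.
  δ = proj₁ (divide 0<mA N)

  0<δ : 0# < δ
  0<δ = proj₁ (proj₂ (divide 0<mA N))

  almostMinimal : AlmostMinimal δ
  almostMinimal =
    let gs , B⊆⋂ , ⋂⊆B = self-intersection G B
        -- The number M of available steps is fixed first, from m(BA); then `ks` of length M is
        -- extracted from m'(B) > 0.
        M , μ<Mδ = archimedean 0<δ (μ (⋂A∈𝒟 gs))
        ks , len , measure⇒large = MeasureLarge.measure⇒Large em ℝ m' M 0<m'B
    in descend δ gs ks
         (Large-mono ks B ⋂[ toList gs ]B B⊆⋂ (measure⇒large (self∈translateLattice G B) ≤-refl))
         ⋂⊆B (≡.subst (λ n → μ (⋂A∈𝒟 gs) < n · δ) (≡.sym len) μ<Mδ)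

  open AlmostMinimal almostMinimal

  C : GroupSubset G
  C = ⋂[ toList gs ]B

  CA : Member (product X C A)
  CA = ⋂A∈𝒟 gs

  Y : GroupSubset G
  Y = LargeStabilizer ks C

  -- Largeness of C supplies some c ∈ C, and CA contains the translate cA, which has the measure of
  -- A.
  mA≤μCA : μ A∈𝒟 ≤ μ CA
  mA≤μCA =
    let c , c∈C = Large⇒nonempty (k ∷ ks) C large in begin
    μ A∈𝒟                 ≈⟨ invariant c A∈𝒟 ⟨
    μ (translate∈ c A∈𝒟)  ≤⟨ monotone _ _ (translate⊆product C A c∈C) ⟩
    μ CA                  ∎

  positive : ∀ {g} → g ∈ power G Y N → 0# < μ (∩∈ (translate∈ g CA) CA)
  positive {g} g∈Yᴺ = begin-strict
    0#                          <⟨ 0<δ ⟩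
    δ                           ≤⟨ +-cancelʳ-≤ (N · δ) (begin
      δ + N · δ                             ≈⟨ proj₂ (proj₂ (divide 0<mA N)) ⟩
      μ A∈𝒟                                 ≤⟨ mA≤μCA ⟩
      μ CA                                  ≤⟨ deficit-power CA δ Y small N g∈Yᴺ ⟩
      μ (∩∈ (translate∈ g CA) CA) + N · δ   ∎) ⟩
    μ (∩∈ (translate∈ g CA) CA) ∎
    where
    small : ∀ {h} → h ∈ Y → μ CA ≤ μ (∩∈ (translate∈ h CA) CA) + δ
    small {h} h∈Y = ≤-trans (minimal h∈Y) (+-monoˡ-≤ δ (stabilizes gs h))

  CA∩⊆BA∩ : ∀ g → translate X g (product X C A) ∩ product X C A ⊆ translate X g (product X B A) ∩ product X B A
  CA∩⊆BA∩ g (x∈gCA , x∈CA) =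
    translate-mono g (product X C A) (product X B A) (product-mono C B A ⊆B) x∈gCA ,
    product-mono C B A ⊆B x∈CA
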